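{- For each even-cyclic $\mathrm{L}^{\circlearrowleft}$-grammar $Gr$ it holds that $L(Gr^{\not\circlearrowleft})\subseteq L(Gr)\subseteq L\big((Gr^{\not\circlearrowleft})^{\mathrm{CS}}\big)$.
   Context: Fix a set $Pr$ of primitive types. Types of $\mathrm{L}$ and of $\mathrm{L}+(\mathrm{CS})$ are built from primitive types using the binary connectives $\backslash$, $/$, $\cdot$; types of $\mathrm{L}^{\circlearrowleft}$ are built using $\backslash$, $/$, $\cdot$ and a unary connective $A\mapsto A^{\circlearrowleft}$. A sequent is $A_1,\dots,A_n\to B$ with $n\ge 1$ and $A_i,B$ types. Capital Latin letters denote types, $\Gamma,\Delta$ finite (possibly empty) sequences of types, $\Pi,\Psi$ nonempty finite sequences of types. The Lambek calculus $\mathrm{L}$ has the axioms and rules: - $(\mathrm{Ax})$: $A\to A$. - $(\backslash\to)$: from $\Gamma,B,\Delta\to C$ and $\Pi\to A$ infer $\Gamma,\Pi,A\backslash B,\Delta\to C$. - $(\to\backslash)$: from $A,\Pi\to B$ infer $\Pi\to A\backslash B$. - $(/\to)$: from $\Gamma,B,\Delta\to C$ and $\Pi\to A$ infer $\Gamma,B/A,\Pi,\Delta\to C$. - $(\to/)$: from $\Pi,A\to B$ infer $\Pi\to B/A$. - $(\cdot\to)$: from $\Gamma,A,B,\Delta\to C$ infer $\Gamma,A\cdot B,\Delta\to C$. - $(\to\cdot)$: from $\Pi\to A$ and $\Psi\to B$ infer $\Pi,\Psi\to A\cdot B$. - $(\mathrm{cut})$: from $\Pi\to A$ and $\Gamma,A,\Delta\to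 B$ infer $\Gamma,\Pi,\Delta\to B$. $\mathrm{L}+(\mathrm{CS})$ is obtained from $\mathrm{L}$ by adding the rule $(\mathrm{CS})$: from $\Pi,\Psi\to A$ infer $\Psi,\Pi\to A$. $\mathrm{L}^{\circlearrowleft}$ is obtained from $\mathrm{L}$ by adding the connective $^{\circlearrowleft}$ (the rules above apply to all types of $\mathrm{L}^{\circlearrowleft}$) and the rules $(\to^{\circlearrowleft})$: from $\Pi\to A$ infer $\Pi\to A^{\circlearrowleft}$; $(^{\circlearrowleft}\to)$: from $B\to A^{\circlearrowleft}$ infer $B^{\circlearrowleft}\to A^{\circlearrowleft}$; $(\circlearrowleft)$: from $\Pi,\Psi\to A^{\circlearrowleft}$ infer $\Psi,\Pi\to A^{\circlearrowleft}$. Grammars. For a calculus $\mathcal{K}$ among these, a $\mathcal{K}$-grammar is a triple $G=\langle\Sigma,S,\triangleright\rangle$ where $\Sigma$ is a finite alphabet, $S$ is a distinguished type of $\mathcal{K}$, and $\triangleright$ is a finite binary relation between $\Sigma$ and the types of $\mathcal{K}$. Its dictionary is the set of types $T$ such that $a\triangleright T$ for some $a\in\Sigma$. The language recognized by $G$ is $L(G)=\{a_1\dots a_n\in\Sigma^+\mid \exists\,T_1,\dots,T_n:\ a_i\triangleright T_i\text{ for all }i,\text{ and } \mathcal{K}\vdash T_1,\dots,T_n\to S\}$, where $\mathcal{K}\vdash$ means derivability in $\mathcal{K}$. Parity. For a type $A$ and a subtype $B$ of $A$, "$B$ is even in $A$" and "$B$ is odd in $A$" are defined by simultaneous recursion.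 $B$ is even in $A$ if: $A=B$; or $A=C^{\circlearrowleft}$ and $B$ is even in $C$; or $A=C\cdot D$ and $B$ is even in $C$ or in $D$; or $A=C\backslash D$ or $A=D/C$, and $B$ is odd in $C$ or even in $D$. $B$ is odd in $A$ if: $A=C^{\circlearrowleft}$ and $B$ is odd in $C$; or $A=C\cdot D$ and $B$ is odd in $C$ or in $D$; or $A=C\backslash D$ or $A=D/C$, and $B$ is even in $C$ or odd in $D$. A type is even-cyclic if it contains no odd subtype of the form $B^{\circlearrowleft}$; it is odd-cyclic if it contains no even subtype of the form $B^{\circlearrowleft}$. An $\mathrm{L}^{\circlearrowleft}$-grammar $\langle\Sigma,S,\triangleright\rangle$ is even-cyclic if all types in its dictionary are odd-cyclic and $S$ is even-cyclic. For a type $A$ of $\mathrm{L}^{\circlearrowleft}$, $A^{\not\circlearrowleft}$ is obtained from $A$ by removing all occurrences of the connective $^{\circlearrowleft}$. For an $\mathrm{L}^{\circlearrowleft}$-grammar $Gr=\langle\Sigma,S,\triangleright\rangle$, $Gr^{\not\circlearrowleft}$ is the $\mathrm{L}$-grammar obtained by replacing $S$ by $S^{\not\circlearrowleft}$ and each pair $a\triangleright T$ by $a\triangleright T^{\not\circlearrowleft}$. For an $\mathrm{L}$-grammar $G$, $G^{\mathrm{CS}}$ denotes the same triple considered as an $(\mathrm{L}+(\mathrm{CS}))$-grammar. -}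

module Defs where

open import Data.Fin.Base using (Fin)
open import Data.List.Base as List using (List; []; _∷_)
open import Data.List.Membership.Propositional using (_∈_)
open import Data.List.NonEmpty.Base using (List⁺; _∷_; [_]; toList; _∷⁺_; _⁺++⁺_; _⁺++_; _++⁺_)
open import Data.List.Relation.Binary.Pointwise.Base using (Pointwise)
open import Data.Nat.Base using (ℕ)
open import Data.Product.Base using (_×_; _,_; ∃; map₂)
open import Function.Bundles using (_↔_)
open import Level using (0ℓ)
open import Relation.Nullary.Negation.Core using (¬_)
open import Relation.Unary using (Pred)

data Calculus : Set where
  L L+CS L↺ : Calculus

-- L and L+CS share one set of connectives; L↺ has one connective more.

data Signature : Set where
  lambek cyclic : Signature

signature : Calculus → Signature
signature L    = lambek
signature L+CS = lambek
signature L↺   = cyclic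

-- `A ⟍ B` is A\B (argument on the left), `B ⟋ A` is B/A (argument on the
-- right).

infix 30 _↺
infixr 25 _∙_
infixr 20 _⟍_
infixl 20 _⟋_

data Type (Pr : Set) : Signature → Set where
  prim : ∀ {s} → Pr → Type Pr s
  _⟍_  : ∀ {s} → Type Pr s → Type Pr s → Type Pr s
  _⟋_  : ∀ {s} → Type Pr s → Type Pr s → Type Pr s
  _∙_  : ∀ {s} → Type Pr s → Type Pr s → Type Pr s
  _↺   : Type Pr cyclic → Type Pr cyclic

-- `K ⊢ Π ⟶ A`: the sequent Π → A is derivable in the calculus K.
-- Possibly empty contexts Γ, Δ are lists; Π, Ψ are nonempty lists.

infix 3 _⊢_⟶_

data _⊢_⟶_ {Pr : Set} :
  (K : Calculus) → List⁺ (Type Pr (signature K)) → Type Pr (signature K) → Set where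

  ax  : ∀ {K A} → K ⊢ [ A ] ⟶ A

  ⟍⟶  : ∀ {K Γ Δ Π A B C} →
        K ⊢ Γ ++⁺ (B ∷ Δ) ⟶ C → K ⊢ Π ⟶ A →
        K ⊢ Γ ++⁺ (Π ⁺++ ((A ⟍ B) ∷ Δ)) ⟶ C

  ⟶⟍  : ∀ {K Π A B} →
        K ⊢ A ∷⁺ Π ⟶ B →
        K ⊢ Π ⟶ A ⟍ B

  ⟋⟶  : ∀ {K Γ Δ Π A B C} →
        K ⊢ Γ ++⁺ (B ∷ Δ) ⟶ C → K ⊢ Π ⟶ A →
        K ⊢ Γ ++⁺ ((B ⟋ A) ∷⁺ (Π ⁺++ Δ)) ⟶ C

  ⟶⟋  : ∀ {K Π A B} →
        K ⊢ Π ⁺++⁺ [ A ] ⟶ B →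
        K ⊢ Π ⟶ B ⟋ A

  ∙⟶  : ∀ {K Γ Δ A B C} →
        K ⊢ Γ ++⁺ (A ∷ B ∷ Δ) ⟶ C →
        K ⊢ Γ ++⁺ ((A ∙ B) ∷ Δ) ⟶ C

  ⟶∙  : ∀ {K Π Ψ A B} →
        K ⊢ Π ⟶ A → K ⊢ Ψ ⟶ B →
        K ⊢ Π ⁺++⁺ Ψ ⟶ A ∙ B

  cut : ∀ {K Γ Δ Π A B} →
        K ⊢ Π ⟶ A → K ⊢ Γ ++⁺ (A ∷ Δ) ⟶ B →
        K ⊢ Γ ++⁺ (Π ⁺++ Δ) ⟶ B

  cs  : ∀ {Π Ψ A} →
        L+CS ⊢ Π ⁺++⁺ Ψ ⟶ A →
        L+CS ⊢ Ψ ⁺++⁺ Π ⟶ A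

  ⟶↺  : ∀ {Π A} →
        L↺ ⊢ Π ⟶ A →
        L↺ ⊢ Π ⟶ A ↺

  ↺⟶  : ∀ {A B} →
        L↺ ⊢ [ B ] ⟶ A ↺ →
        L↺ ⊢ [ B ↺ ] ⟶ A ↺

  rot : ∀ {Π Ψ A} →
        L↺ ⊢ Π ⁺++⁺ Ψ ⟶ A ↺ →
        L↺ ⊢ Ψ ⁺++⁺ Π ⟶ A ↺

-- The relation ▷ between letters and types is given by the finite list of
-- its pairs.

record Grammar (Pr : Set) (K : Calculus) : Set₁ where
  field
    Σ       : Set
    finite  : ∃ λ (n : ℕ) → Σ ↔ Fin n
    S       : Type Pr (signature K)
    lexicon : List (Σ × Type Pr (signature K))

  infix 4 _▷_
  _▷_ : Σ → Type Pr (signature K) → Set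
  a ▷ T = (a , T) ∈ lexicon

  Dictionary : Pred (Type Pr (signature K)) 0ℓ
  Dictionary T = ∃ λ a → a ▷ T

  Language : Pred (List⁺ Σ) 0ℓ
  Language w = ∃ λ (Ts : List⁺ (Type Pr (signature K))) →
    Pointwise _▷_ (toList w) (toList Ts) × K ⊢ Ts ⟶ S

open Grammar public using (Dictionary; Language)

-- `B EvenIn A` and `B OddIn A`: B occurs in A as a subtype under an even,
-- respectively odd, number of connectives ⟍, ⟋ on their argument side.

infix 4 _EvenIn_ _OddIn_

data _EvenIn_ {Pr : Set} (B : Type Pr cyclic) : Type Pr cyclic → Set
data _OddIn_  {Pr : Set} (B : Type Pr cyclic) : Type Pr cyclic → Set

data _EvenIn_ B where
  here   : B EvenIn B
  under↺ : ∀ {C} → B EvenIn C → B EvenIn C ↺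
  ∙ˡ     : ∀ {C D} → B EvenIn C → B EvenIn C ∙ D
  ∙ʳ     : ∀ {C D} → B EvenIn D → B EvenIn C ∙ D
  ⟍ˡ     : ∀ {C D} → B OddIn C → B EvenIn C ⟍ D
  ⟍ʳ     : ∀ {C D} → B EvenIn D → B EvenIn C ⟍ D
  ⟋ˡ     : ∀ {C D} → B EvenIn D → B EvenIn D ⟋ C
  ⟋ʳ     : ∀ {C D} → B OddIn C → B EvenIn D ⟋ C

data _OddIn_ B where
  under↺ : ∀ {C} → B OddIn C → B OddIn C ↺
  ∙ˡ     : ∀ {C D} → B OddIn C → B OddIn C ∙ D
  ∙ʳ     : ∀ {C D} → B OddIn D → B OddIn C ∙ D
  ⟍ˡ     : ∀ {C D} → B EvenIn C → B OddIn C ⟍ D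
  ⟍ʳ     : ∀ {C D} → B OddIn D → B OddIn C ⟍ D
  ⟋ˡ     : ∀ {C D} → B OddIn D → B OddIn D ⟋ C
  ⟋ʳ     : ∀ {C D} → B EvenIn C → B OddIn D ⟋ C

EvenCyclic OddCyclic : ∀ {Pr} → Pred (Type Pr cyclic) 0ℓ
EvenCyclic A = ¬ ∃ λ B → B ↺ OddIn A
OddCyclic  A = ¬ ∃ λ B → B ↺ EvenIn A

-- The parities differ on purpose: dictionary types stand in antecedents, S in
-- the succedent.

EvenCyclicGrammar : ∀ {Pr} → Grammar Pr L↺ → Set
EvenCyclicGrammar Gr =
  (∀ T → Dictionary Gr T → OddCyclic T) × EvenCyclic (Grammar.S Gr)

erase : ∀ {Pr} → Type Pr cyclic → Type Pr lambek
erase (prim p) = prim p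
erase (A ⟍ B)  = erase A ⟍ erase B
erase (A ⟋ B)  = erase A ⟋ erase B
erase (A ∙ B)  = erase A ∙ erase B
erase (A ↺)    = erase A

eraseGrammar : ∀ {Pr} → Grammar Pr L↺ → Grammar Pr L
eraseGrammar Gr = record
  { Σ       = Σ
  ; finite  = finite
  ; S       = erase S
  ; lexicon = List.map (map₂ erase) lexicon
  } where open Grammar Gr

infix 30 _^CS

_^CS : ∀ {Pr} → Grammar Pr L → Grammar Pr L+CS
G ^CS = record { Grammar G }

{-# OPTIONS --safe #-}
-- Erasing ↺ turns each rule of L↺ into a rule of L+CS or into a repetition of
-- its premise, which gives the second inclusion.  For the first one, L is a
-- fragment of L↺, and since A → A ↺ is derivable, adding ↺ at even positions
-- weakens a type and adding it at odd positions strengthens it; by the parity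
-- conditions, cuts then restore every ↺ of the lexicon and of S.
module Submission where

open import Defs
open import Data.List.Base as List using (List; []; _∷_; _++_)
open import Data.List.Membership.Propositional.Properties using (∈-map⁺; ∈-map⁻)
open import Data.List.NonEmpty.Base
  using (List⁺; _∷_; [_]; _∷⁺_; _⁺++⁺_; _⁺++_; _++⁺_; map)
open import Data.List.NonEmpty.Properties using (++-++⁺; map-++⁺; map-⁺++⁺)
open import Data.List.Properties using (map-++; ++-identityʳ)
open import Data.List.Relation.Binary.Pointwise using (Pointwise; []; _∷_)
open import Data.Product.Base using (_×_; _,_; ∃; map₂)
open import Function.Base using (_∘_; id)
open import Level using (0ℓ)
open import Relation.Binary.Core using (REL)
open import Relation.Binary.PropositionalEquality
  using (_≡_; refl; sym; cong; cong₂; subst)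
open import Relation.Unary using (_⊆_)

private
  variable
    Pr X Y Z : Set
    K K′ : Calculus
    s s′ : Signature

map-⁺++ : ∀ (f : X → Y) xs ys → map f (xs ⁺++ ys) ≡ map f xs ⁺++ List.map f ys
map-⁺++ f (x ∷ xs) ys = cong (f x ∷_) (map-++ f xs ys)

-- Serves to choose, letter by letter, an original lexicon type (related by `P`) behind each erased
-- one, along with the sequent (`Q`) linking the two.
Pointwise-split : ∀ {R : REL X Y 0ℓ} {P : REL X Z 0ℓ} {Q : REL Z Y 0ℓ} →
  (∀ {x y} → R x y → ∃ λ z → P x z × Q z y) →
  ∀ {xs ys} → Pointwise R xs ys →
  ∃ λ zs → Pointwise P xs zs × Pointwise Q zs ys
Pointwise-split split []       = [] , [] , []
Pointwise-split split (r ∷ rs) =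
  let z  , p  , q  = split r
      zs , ps , qs = Pointwise-split split rs
  in z ∷ zs , p ∷ ps , q ∷ qs

Pointwise-mapʳ : ∀ {R : REL X Y 0ℓ} {S : REL X Z 0ℓ} (f : Y → Z) →
  (∀ {x y} → R x y → S x (f y)) →
  ∀ {xs ys} → Pointwise R xs ys → Pointwise S xs (List.map f ys)
Pointwise-mapʳ f R⇒S []       = []
Pointwise-mapʳ f R⇒S (r ∷ rs) = R⇒S r ∷ Pointwise-mapʳ f R⇒S rs

antecedent : ∀ {Π Ψ : List⁺ (Type Pr (signature K))} {A} →
  Π ≡ Ψ → K ⊢ Π ⟶ A → K ⊢ Ψ ⟶ A
antecedent refl d = d

⟍-mono : ∀ {A A′ B B′ : Type Pr (signature K)} →
  K ⊢ [ A′ ] ⟶ A → K ⊢ [ B ] ⟶ B′ → K ⊢ [ A ⟍ B ] ⟶ A′ ⟍ B′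
⟍-mono a b = ⟶⟍ (⟍⟶ {Γ = []} {Δ = []} b a)

⟋-mono : ∀ {A A′ B B′ : Type Pr (signature K)} →
  K ⊢ [ A′ ] ⟶ A → K ⊢ [ B ] ⟶ B′ → K ⊢ [ B ⟋ A ] ⟶ B′ ⟋ A′
⟋-mono a b = ⟶⟋ (⟋⟶ {Γ = []} {Δ = []} b a)

∙-mono : ∀ {A A′ B B′ : Type Pr (signature K)} →
  K ⊢ [ A ] ⟶ A′ → K ⊢ [ B ] ⟶ B′ → K ⊢ [ A ∙ B ] ⟶ A′ ∙ B′
∙-mono a b = ∙⟶ {Γ = []} {Δ = []} (⟶∙ a b)

-- The prefix Γ collects the types that have already been replaced.
cut-each : ∀ (Γ : List (Type Pr (signature K))) {A B C Δ Δ′} →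
  Pointwise (λ A B → K ⊢ [ A ] ⟶ B) (A ∷ Δ) (B ∷ Δ′) →
  K ⊢ Γ ++⁺ (B ∷ Δ′) ⟶ C → K ⊢ Γ ++⁺ (A ∷ Δ) ⟶ C
cut-each Γ (a ∷ [])         d = cut {Γ = Γ} a d
cut-each Γ {A} (a ∷ b ∷ ds) d =
  antecedent (++-++⁺ Γ)
    (cut-each (Γ ++ A ∷ []) (b ∷ ds)
      (antecedent (sym (++-++⁺ Γ)) (cut {Γ = Γ} a d)))

-- With an arbitrary target signature, the same map both erases ↺ and embeds the
-- types of L into those of L↺.
forget : Type Pr s → Type Pr s′
forget (prim p) = prim p
forget (A ⟍ B)  = forget A ⟍ forget B
forget (A ⟋ B)  = forget A ⟋ forget B
forget (A ∙ B)  = forget A ∙ forget B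
forget (A ↺)    = forget A

-- Translated derivations speak of `forget A`, the erased grammar of `erase A`; this reconciles the
-- two.
forget≡erase : (A : Type Pr cyclic) → forget A ≡ erase A
forget≡erase (prim p) = refl
forget≡erase (A ⟍ B)  = cong₂ _⟍_ (forget≡erase A) (forget≡erase B)
forget≡erase (A ⟋ B)  = cong₂ _⟋_ (forget≡erase A) (forget≡erase B)
forget≡erase (A ∙ B)  = cong₂ _∙_ (forget≡erase A) (forget≡erase B)
forget≡erase (A ↺)    = forget≡erase A

-- Restricting to these two pairs lets one induction on derivations serve both inclusions: `L+CS` is
-- never a source, so the case `cs` does not arise.
data _⇝_ : Calculus → Calculus → Set where
  L⇝L↺    : L ⇝ L↺
  L↺⇝L+CS : L↺ ⇝ L+CS

module _ {A : Type Pr (signature K′)} where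

  forget-++⁺ : ∀ (Γ : List (Type Pr s)) {Π} →
    K′ ⊢ map forget (Γ ++⁺ Π) ⟶ A → K′ ⊢ List.map forget Γ ++⁺ map forget Π ⟶ A
  forget-++⁺ Γ {Π} = antecedent (map-++⁺ forget Γ Π)

  -- The rules build the part after Γ from separately mapped pieces, so that part is a variable `Ψ`
  -- tied to `map forget Π` by an equation.
  unforget-++⁺ : ∀ (Γ : List (Type Pr s)) {Π Ψ} → Ψ ≡ map forget Π →
    K′ ⊢ List.map forget Γ ++⁺ Ψ ⟶ A → K′ ⊢ map forget (Γ ++⁺ Π) ⟶ A
  unforget-++⁺ Γ {Π} refl = antecedent (sym (map-++⁺ forget Γ Π))

  forget-⁺++⁺ : ∀ (Π Ψ : List⁺ (Type Pr s)) →
    K′ ⊢ map forget (Π ⁺++⁺ Ψ) ⟶ A → K′ ⊢ map forget Π ⁺++⁺ map forget Ψ ⟶ A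
  forget-⁺++⁺ Π Ψ = antecedent (map-⁺++⁺ forget Π Ψ)

  unforget-⁺++⁺ : ∀ (Π Ψ : List⁺ (Type Pr s)) →
    K′ ⊢ map forget Π ⁺++⁺ map forget Ψ ⟶ A → K′ ⊢ map forget (Π ⁺++⁺ Ψ) ⟶ A
  unforget-⁺++⁺ Π Ψ = antecedent (sym (map-⁺++⁺ forget Π Ψ))

forget-⊢ : ∀ {Π : List⁺ (Type Pr (signature K))} {A} → K ⇝ K′ →
  K ⊢ Π ⟶ A → K′ ⊢ map forget Π ⟶ forget A
forget-⊢ t ax = ax
forget-⊢ t (⟍⟶ {Γ = Γ} {Δ} {Π} d e) =
  unforget-++⁺ Γ (sym (map-⁺++ forget Π _))
    (⟍⟶ {Γ = List.map forget Γ} (forget-++⁺ Γ (forget-⊢ t d)) (forget-⊢ t e))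
forget-⊢ t (⟶⟍ d) = ⟶⟍ (forget-⊢ t d)
forget-⊢ t (⟋⟶ {Γ = Γ} {Δ} {Π} d e) =
  unforget-++⁺ Γ (cong (_ ∷⁺_) (sym (map-⁺++ forget Π Δ)))
    (⟋⟶ {Γ = List.map forget Γ} (forget-++⁺ Γ (forget-⊢ t d)) (forget-⊢ t e))
forget-⊢ t (⟶⟋ {Π = Π} d) = ⟶⟋ (forget-⁺++⁺ Π [ _ ] (forget-⊢ t d))
forget-⊢ t (∙⟶ {Γ = Γ} d) =
  unforget-++⁺ Γ refl
    (∙⟶ {Γ = List.map forget Γ} (forget-++⁺ Γ (forget-⊢ t d)))
forget-⊢ t (⟶∙ {Π = Π} {Ψ} d e) =
  unforget-⁺++⁺ Π Ψ (⟶∙ (forget-⊢ t d) (forget-⊢ t e))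
forget-⊢ t (cut {Γ = Γ} {Δ} {Π} d e) =
  unforget-++⁺ Γ (sym (map-⁺++ forget Π Δ))
    (cut {Γ = List.map forget Γ} (forget-⊢ t d) (forget-++⁺ Γ (forget-⊢ t e)))
-- After erasure, premise and conclusion of `⟶↺` and of `↺⟶` coincide; `rot` becomes `cs`, which
-- rotates under any succedent.
forget-⊢ L↺⇝L+CS (⟶↺ d) = forget-⊢ L↺⇝L+CS d
forget-⊢ L↺⇝L+CS (↺⟶ d) = forget-⊢ L↺⇝L+CS d
forget-⊢ L↺⇝L+CS (rot {Π} {Ψ} d) =
  unforget-⁺++⁺ Ψ Π
    (cs {Π = map forget Π} (forget-⁺++⁺ Π Ψ (forget-⊢ L↺⇝L+CS d)))

-- Mutual induction on the type: the argument side of a division reverses both the parity of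
-- subtypes and the direction of derivability. The outer `forget` embeds the erased type back into
-- `L↺`.
OddCyclic⇒⟶forget : (A : Type Pr cyclic) →
  OddCyclic A → L↺ ⊢ [ A ] ⟶ forget (erase A)
EvenCyclic⇒forget⟶ : (A : Type Pr cyclic) →
  EvenCyclic A → L↺ ⊢ [ forget (erase A) ] ⟶ A

OddCyclic⇒⟶forget (prim p) odd = ax
OddCyclic⇒⟶forget (A ⟍ B) odd =
  ⟍-mono (EvenCyclic⇒forget⟶ A (odd ∘ map₂ ⟍ˡ))
         (OddCyclic⇒⟶forget B (odd ∘ map₂ ⟍ʳ))
OddCyclic⇒⟶forget (B ⟋ A) odd =
  ⟋-mono (EvenCyclic⇒forget⟶ A (odd ∘ map₂ ⟋ʳ))
         (OddCyclic⇒⟶forget B (odd ∘ map₂ ⟋ˡ))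
OddCyclic⇒⟶forget (A ∙ B) odd =
  ∙-mono (OddCyclic⇒⟶forget A (odd ∘ map₂ ∙ˡ))
         (OddCyclic⇒⟶forget B (odd ∘ map₂ ∙ʳ))
-- A type is an even subtype of itself, so an odd-cyclic type cannot have ↺ outermost.
OddCyclic⇒⟶forget (A ↺) odd with () ← odd (A , here)

EvenCyclic⇒forget⟶ (prim p) even = ax
EvenCyclic⇒forget⟶ (A ⟍ B) even =
  ⟍-mono (OddCyclic⇒⟶forget A (even ∘ map₂ ⟍ˡ))
         (EvenCyclic⇒forget⟶ B (even ∘ map₂ ⟍ʳ))
EvenCyclic⇒forget⟶ (B ⟋ A) even =
  ⟋-mono (OddCyclic⇒⟶forget A (even ∘ map₂ ⟋ʳ))
         (EvenCyclic⇒forget⟶ B (even ∘ map₂ ⟋ˡ))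
EvenCyclic⇒forget⟶ (A ∙ B) even =
  ∙-mono (EvenCyclic⇒forget⟶ A (even ∘ map₂ ∙ˡ))
         (EvenCyclic⇒forget⟶ B (even ∘ map₂ ∙ʳ))
EvenCyclic⇒forget⟶ (A ↺) even =
  ⟶↺ (EvenCyclic⇒forget⟶ A (even ∘ map₂ under↺))

module _ (Gr : Grammar Pr L↺) where
  open Grammar Gr using (S; _▷_)

  restore : (∀ T → Dictionary Gr T → OddCyclic T) →
    ∀ {a U} → Grammar._▷_ (eraseGrammar Gr) a U →
    ∃ λ T → a ▷ T × L↺ ⊢ [ T ] ⟶ forget U
  -- Several types may share an erasure, so `T` is read off the lexicon pair from which `U` arises.
  restore odd a▷U with (a , T) , a▷T , refl ← ∈-map⁻ (map₂ erase) a▷U =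
    T , a▷T , OddCyclic⇒⟶forget T (odd T (a , a▷T))

  erased-⊆ : EvenCyclicGrammar Gr → Language (eraseGrammar Gr) ⊆ Language Gr
  erased-⊆ (odd , even) (U ∷ Us , w▷Us , d)
    with T ∷ Ts , w▷Ts , Ts⟶Us ← Pointwise-split (restore odd) w▷Us =
      T ∷ Ts , w▷Ts ,
      -- The inner cut first turns the succedent into `S`, its empty right context leaving a
      -- trailing `++ []`; the antecedent types are then replaced one at a time.
      cut-each [] (Pointwise-mapʳ forget id Ts⟶Us)
        (antecedent (cong (forget U ∷_) (++-identityʳ (List.map forget Us)))
          (cut {Γ = []} (forget-⊢ L⇝L↺ d) (EvenCyclic⇒forget⟶ S even)))

  ⊆-erased^CS : Language Gr ⊆ Language (eraseGrammar Gr ^CS)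
  ⊆-erased^CS (Ts , w▷Ts , d) =
    map forget Ts ,
    Pointwise-mapʳ forget
      (λ {a} {T} a▷T → subst (λ U → Grammar._▷_ (eraseGrammar Gr) a U)
        (sym (forget≡erase T)) (∈-map⁺ (map₂ erase) a▷T))
      w▷Ts ,
    subst (L+CS ⊢ _ ⟶_) (forget≡erase S) (forget-⊢ L↺⇝L+CS d)

theorem9 : (Pr : Set) (Gr : Grammar Pr L↺) → EvenCyclicGrammar Gr →
    (Language (eraseGrammar Gr) ⊆ Language Gr) ×
    (Language Gr ⊆ Language (eraseGrammar Gr ^CS))
theorem9 Pr Gr ec = erased-⊆ Gr ec , ⊆-erased^CS Gr
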